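{- Let $\Gamma\subseteq\mathbf{For}$ be a finite set of formulas and $\alpha\in\mathbf{For}$ a formula. Then $\alpha$ is an algebraic consequence of $\Gamma$ if and only if for every algebraic model $(\mathbf{BT},h)$ based on the finite $HT$-algebra $\mathbf{BT}$, $h(\gamma)=1$ for all $\gamma\in\Gamma$ implies $h(\alpha)=1$; that is, $$\Gamma\models_{Alg}\alpha\quad\text{if and only if}\quad\Gamma\models_{BT}\alpha .$$
   Context: Language. $\mathbf{VarProp}$ is a countable set of propositional variables. $\mathbf{For}$ is the least set containing $\mathbf{VarProp}$ and closed under the binary connectives $\wedge,\vee,\Rightarrow$ and the unary connectives $\neg,S_1,S_2$ (the freely generated set of formulas). HT-algebras. An $HT$-algebra is an algebra $A=(A,0,1,\wedge,\vee,\Rightarrow,\neg,S_1,S_2)$ such that $(A,0,1,\wedge,\vee,\Rightarrow,\neg)$ is a Heyting algebra (with $\neg a=a\Rightarrow 0$), and for all $a,b\in A$ and all $i,j\in\{1,2\}$: $S_i(a\wedge b)=S_ia\wedge S_ib$; $S_i(a\vee b)=S_ia\vee S_ib$; $S_2(a\Rightarrow b)=(S_2a\Rightarrow S_2b)$; $S_1(a\Rightarrow b)=(S_1a\Rightarrow S_1b)\wedge(S_2a\Rightarrow S_2b)$; $S_iS_ja=S_ja$; $S_1a\vee a=a$; $S_1a\vee\neg S_1a=1$. Algebraic semantics. An algebraic model is a pair $(A,h)$ where $A$ is an $HT$-algebra and $h:\mathbf{For}\to A$ is a homomorphism, i.e. $h$ preserves $\wedge,\vee,\Rightarrow,\neg,S_1,S_2$.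 $\Gamma\models_{Alg}\alpha$ means: for every algebraic model $(A,h)$, if $h(\gamma)=1$ for all $\gamma\in\Gamma$, then $h(\alpha)=1$. $\Gamma\models_{BT}\alpha$ means the same with $A$ restricted to be $\mathbf{BT}$ ($h$ arbitrary). The algebra $\mathbf{BT}$. Let $T=\{t_1,t_2\}$ be a two-element ordered set with $t_1\le t_2$, $t_1\ne t_2$, and for $t\in T$ let $F(t)=\{w\in T: t\le w\}$. The underlying set of $\mathbf{BT}$ is $\{\emptyset,F(t_2),F(t_1)\}$ (so $F(t_1)=T$), a three-element chain under inclusion, with $0=\emptyset$, $1=T$, $\wedge=\cap$, $\vee=\cup$; for $X$ in this set, $S_i(X)=S_{t_i}(X)=T$ if $t_i\in X$ and $\emptyset$ otherwise; $CX$ is the set complement in $T$ of $S_1(X)$; $X\Rightarrow Y=Y\cup\bigcap_{k=1}^{2}(CS_kX\cup S_kY)$, and $\neg X=X\Rightarrow\emptyset$. -}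

module Defs where

open import Algebra.Core using (Op₁; Op₂)
import Data.Bool.Properties as Bool
open import Data.Bool.Base using (if_then_else_)
open import Data.Fin.Base as Fin using (Fin; zero; suc)
import Data.Fin.Properties as Fin
open import Data.Fin.Subset as Subset using (Subset; _∩_; _∪_; ∁; ⋂; _⊆_)
open import Data.Fin.Subset.Properties as Subset using (_∈?_; _⊆?_)
open import Data.List.Base as List using (List; []; _∷_)
open import Data.List.Membership.Propositional using (_∈_)
open import Data.List.Relation.Unary.All as All using (all?)
open import Data.List.Relation.Unary.Any using (here; there)
open import Data.Product.Base using (∃; _×_; _,_)
open import Data.Vec.Base as Vec using ()
import Data.Vec.Properties as Vec
open import Function.Base using (_on_)
open import Level using (Level; _⊔_; 0ℓ) renaming (suc to lsuc)
open import Relation.Binary.Core using (Rel)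
open import Relation.Binary.Definitions using (DecidableEquality)
open import Relation.Binary.Lattice.Bundles using (HeytingAlgebra)
import Relation.Binary.Lattice.Properties.HeytingAlgebra as HeytingProperties
open import Relation.Binary.PropositionalEquality.Core
  using (_≡_; refl; sym; trans; cong)
open import Relation.Nullary.Decidable
  using (Dec; does; True; toWitness; _×-dec_; _→-dec_)
open import Relation.Unary using (Pred; Decidable; _≐_)

private
  variable
    v ℓ : Level

------------------------------------------------------------------------
-- Language

-- The index set {1,2} of the operators S₁ and S₂.
Index : Set
Index = Fin 2

pattern 𝟏 = zero
pattern 𝟐 = suc zero

infixr 7 _`∧_
infixr 6 _`∨_
infixr 5 _`⇒_
infix  8 `¬_

data For (VarProp : Set v) : Set v where
  var  : VarProp → For VarProp
  _`∧_ : For VarProp → For VarProp → For VarProp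
  _`∨_ : For VarProp → For VarProp → For VarProp
  _`⇒_ : For VarProp → For VarProp → For VarProp
  `¬_  : For VarProp → For VarProp
  `S   : Index → For VarProp → For VarProp

Finite : {A : Set v} → Pred A ℓ → Set (v ⊔ ℓ)
Finite P = ∃ λ xs → P ≐ (_∈ xs)

------------------------------------------------------------------------
-- HT-algebras

-- Equality in the underlying Heyting algebra is a setoid equality, so the
-- operators Sᵢ must be required to respect it.
record HTAlgebra c ℓ₁ ℓ₂ : Set (lsuc (c ⊔ ℓ₁ ⊔ ℓ₂)) where
  field
    heytingAlgebra : HeytingAlgebra c ℓ₁ ℓ₂

  open HeytingAlgebra heytingAlgebra public
  -- ¬ x = x ⇨ ⊥
  open HeytingProperties heytingAlgebra public using (¬_)

  field
    S      : Index → Op₁ Carrier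
    S-cong : ∀ i {a b} → a ≈ b → S i a ≈ S i b
    S-∧    : ∀ i a b → S i (a ∧ b) ≈ S i a ∧ S i b
    S-∨    : ∀ i a b → S i (a ∨ b) ≈ S i a ∨ S i b
    S₂-⇨   : ∀ a b → S 𝟐 (a ⇨ b) ≈ (S 𝟐 a ⇨ S 𝟐 b)
    S₁-⇨   : ∀ a b → S 𝟏 (a ⇨ b) ≈ (S 𝟏 a ⇨ S 𝟏 b) ∧ (S 𝟐 a ⇨ S 𝟐 b)
    S-S    : ∀ i j a → S i (S j a) ≈ S j a
    S₁-≤   : ∀ a → S 𝟏 a ∨ a ≈ a
    S₁-lem : ∀ a → S 𝟏 a ∨ ¬ S 𝟏 a ≈ ⊤

------------------------------------------------------------------------
-- Algebraic semantics

record IsHomomorphism {c ℓ₁ ℓ₂} {VarProp : Set v} (A : HTAlgebra c ℓ₁ ℓ₂)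
                      (h : For VarProp → HTAlgebra.Carrier A)
                      : Set (v ⊔ ℓ₁) where
  open HTAlgebra A
  field
    ∧-homo : ∀ φ ψ → h (φ `∧ ψ) ≈ h φ ∧ h ψ
    ∨-homo : ∀ φ ψ → h (φ `∨ ψ) ≈ h φ ∨ h ψ
    ⇒-homo : ∀ φ ψ → h (φ `⇒ ψ) ≈ (h φ ⇨ h ψ)
    ¬-homo : ∀ φ → h (`¬ φ) ≈ (¬ h φ)
    S-homo : ∀ i φ → h (`S i φ) ≈ S i (h φ)

-- Consequence over all models (A , h) based on a given algebra A.
infix 4 _⊨[_]_
_⊨[_]_ : ∀ {c ℓ₁ ℓ₂} {VarProp : Set v} →
         Pred (For VarProp) ℓ → HTAlgebra c ℓ₁ ℓ₂ → For VarProp →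
         Set (v ⊔ ℓ ⊔ c ⊔ ℓ₁)
_⊨[_]_ {VarProp = VarProp} Γ A α =
  (h : For VarProp → Carrier) → IsHomomorphism A h →
  (∀ γ → Γ γ → h γ ≈ ⊤) → h α ≈ ⊤
  where open HTAlgebra A

-- The class of all HT-algebras is relative to universe levels.
infix 4 _⊨Alg⟨_,_,_⟩_
_⊨Alg⟨_,_,_⟩_ : {VarProp : Set v} → Pred (For VarProp) ℓ →
                (c ℓ₁ ℓ₂ : Level) → For VarProp →
                Set (v ⊔ ℓ ⊔ lsuc (c ⊔ ℓ₁ ⊔ ℓ₂))
Γ ⊨Alg⟨ c , ℓ₁ , ℓ₂ ⟩ α = (A : HTAlgebra c ℓ₁ ℓ₂) → Γ ⊨[ A ] α

------------------------------------------------------------------------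
-- The algebra BT

-- T = {t₁ , t₂}, ordered by the usual order of Fin 2, so that t₁ ≤ t₂.
T : Set
T = Fin 2

-- The index i names the element tᵢ.
t : Index → T
t i = i

F : T → Subset 2
F u = Vec.tabulate λ w → does (u Fin.≤? w)

carrierBT : List (Subset 2)
carrierBT = Subset.⊥ ∷ F (t 𝟐) ∷ F (t 𝟏) ∷ []

Sₛ : Index → Op₁ (Subset 2)
Sₛ i X = if does (t i ∈? X) then Subset.⊤ else Subset.⊥

Cₛ : Op₁ (Subset 2)
Cₛ X = ∁ (Sₛ 𝟏 X)

infixr 5 _⇒ₛ_
_⇒ₛ_ : Op₂ (Subset 2)
X ⇒ₛ Y = Y ∪ ⋂ (List.tabulate λ k → Cₛ (Sₛ k X) ∪ Sₛ k Y)

private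
  _≟ₛ_ : DecidableEquality (Subset 2)
  _≟ₛ_ = Vec.≡-dec Bool._≟_

  open import Data.List.Membership.DecPropositional _≟ₛ_
    using () renaming (_∈?_ to _∈ₗ?_)

  B : List (Subset 2)
  B = carrierBT

  -- Facts about all elements of BT, proved by evaluating a decision procedure.
  check₁ : ∀ {p} {P : Pred (Subset 2) p} (P? : Decidable P)
           {_ : True (all? P? B)} → ∀ {X} → X ∈ B → P X
  check₁ P? {ok} = All.lookup (toWitness ok)

  check₂ : ∀ {p} {P : Rel (Subset 2) p} (P? : ∀ X Y → Dec (P X Y))
           {_ : True (all? (λ X → all? (P? X) B) B)} →
           ∀ {X Y} → X ∈ B → Y ∈ B → P X Y
  check₂ P? {ok} x y = All.lookup (check₁ (λ X → all? (P? X) B) {ok} x) y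

  equal₁ : (f g : Op₁ (Subset 2)) {_ : True (all? (λ X → f X ≟ₛ g X) B)} →
           ∀ {X} → X ∈ B → f X ≡ g X
  equal₁ f g {ok} = check₁ (λ X → f X ≟ₛ g X) {ok}

  equal₂ : (f g : Op₂ (Subset 2))
           {_ : True (all? (λ X → all? (λ Y → f X Y ≟ₛ g X Y) B) B)} →
           ∀ {X Y} → X ∈ B → Y ∈ B → f X Y ≡ g X Y
  equal₂ f g {ok} = check₂ (λ X Y → f X Y ≟ₛ g X Y) {ok}

∩-closed : ∀ {X Y} → X ∈ carrierBT → Y ∈ carrierBT → X ∩ Y ∈ carrierBT
∩-closed = check₂ λ X Y → (X ∩ Y) ∈ₗ? B

∪-closed : ∀ {X Y} → X ∈ carrierBT → Y ∈ carrierBT → X ∪ Y ∈ carrierBT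
∪-closed = check₂ λ X Y → (X ∪ Y) ∈ₗ? B

⇒-closed : ∀ {X Y} → X ∈ carrierBT → Y ∈ carrierBT → (X ⇒ₛ Y) ∈ carrierBT
⇒-closed = check₂ λ X Y → (X ⇒ₛ Y) ∈ₗ? B

S-closed : ∀ i {X} → X ∈ carrierBT → Sₛ i X ∈ carrierBT
S-closed 𝟏 = check₁ λ X → Sₛ 𝟏 X ∈ₗ? B
S-closed 𝟐 = check₁ λ X → Sₛ 𝟐 X ∈ₗ? B

-- Elements of BT are equal when they are equal as subsets of T.
record ElemBT : Set where
  constructor _,_
  field
    set : Subset 2
    mem : set ∈ carrierBT

open ElemBT public

heytingBT : HeytingAlgebra 0ℓ 0ℓ 0ℓ
heytingBT = record
  { Carrier = ElemBT
  ; _≈_     = _≡_ on set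
  ; _≤_     = λ X Y → set X ⊆ set Y
  ; _∨_     = λ X Y → (set X ∪ set Y) , ∪-closed (mem X) (mem Y)
  ; _∧_     = λ X Y → (set X ∩ set Y) , ∩-closed (mem X) (mem Y)
  ; _⇨_     = λ X Y → (set X ⇒ₛ set Y) , ⇒-closed (mem X) (mem Y)
  ; ⊤       = Subset.⊤ , there (there (here refl))
  ; ⊥       = Subset.⊥ , here refl
  ; isHeytingAlgebra = record
    { isBoundedLattice = record
      { isLattice = record
        { isPartialOrder = record
          { isPreorder = record
            { isEquivalence = record { refl = refl ; sym = sym ; trans = trans }
            ; reflexive     = λ eq → Subset.⊆-reflexive eq
            ; trans         = λ p q x∈ → q (p x∈)
            }
          ; antisym = λ p q → Subset.⊆-antisym p q
          }
        ; supremum = λ X Y →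
              Subset.p⊆p∪q (set Y)
            , Subset.q⊆p∪q (set X) (set Y)
            , λ Z p q x∈ → case-∪ {set X} {set Y} {set Z} p q x∈
        ; infimum  = λ X Y →
              Subset.p∩q⊆p (set X) (set Y)
            , Subset.p∩q⊆q (set X) (set Y)
            , λ Z p q x∈ → Subset.x∈p∩q⁺ (p x∈ , q x∈)
        }
      ; maximum = λ X → Subset.⊆-max (set X)
      ; minimum = λ X → Subset.⊆-min (set X)
      }
    ; exponential = λ W X Y → expo (mem W) (mem X) (mem Y)
    }
  }
  where
  open import Data.Sum.Base using ([_,_]′)

  case-∪ : ∀ {X Y Z : Subset 2} → X ⊆ Z → Y ⊆ Z → X ∪ Y ⊆ Z
  case-∪ {X} {Y} p q x∈ = [ (λ x → p x) , (λ y → q y) ]′ (Subset.x∈p∪q⁻ X Y x∈)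

  Expo : Subset 2 → Subset 2 → Subset 2 → Set
  Expo W X Y = (W ∩ X ⊆ Y → W ⊆ (X ⇒ₛ Y)) × (W ⊆ (X ⇒ₛ Y) → W ∩ X ⊆ Y)

  Expo? : ∀ W X Y → Dec (Expo W X Y)
  Expo? W X Y = ((W ∩ X ⊆? Y) →-dec (W ⊆? (X ⇒ₛ Y)))
          ×-dec ((W ⊆? (X ⇒ₛ Y)) →-dec (W ∩ X ⊆? Y))

  expo : ∀ {W X Y} → W ∈ B → X ∈ B → Y ∈ B → Expo W X Y
  expo w x y = All.lookup
    (check₂ (λ W X → all? (λ Y → Expo? W X Y) B) w x) y

BT : HTAlgebra 0ℓ 0ℓ 0ℓ
BT = record
  { heytingAlgebra = heytingBT
  ; S      = λ i X → Sₛ i (set X) , S-closed i (mem X)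
  ; S-cong = λ i → cong (Sₛ i)
  ; S-∧    = λ i X Y → S-∩ i (mem X) (mem Y)
  ; S-∨    = λ i X Y → S-∪ i (mem X) (mem Y)
  ; S₂-⇨   = λ X Y → equal₂ (λ X Y → Sₛ 𝟐 (X ⇒ₛ Y))
                            (λ X Y → Sₛ 𝟐 X ⇒ₛ Sₛ 𝟐 Y) (mem X) (mem Y)
  ; S₁-⇨   = λ X Y → equal₂ (λ X Y → Sₛ 𝟏 (X ⇒ₛ Y))
                            (λ X Y → (Sₛ 𝟏 X ⇒ₛ Sₛ 𝟏 Y) ∩ (Sₛ 𝟐 X ⇒ₛ Sₛ 𝟐 Y))
                            (mem X) (mem Y)
  ; S-S    = λ i j X → S-S i j (mem X)
  ; S₁-≤   = λ X → equal₁ (λ X → Sₛ 𝟏 X ∪ X) (λ X → X) (mem X)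
  ; S₁-lem = λ X → equal₁ (λ X → Sₛ 𝟏 X ∪ (Sₛ 𝟏 X ⇒ₛ Subset.⊥))
                          (λ _ → Subset.⊤) (mem X)
  }
  where
  S-∩ : ∀ i {X Y} → X ∈ B → Y ∈ B → Sₛ i (X ∩ Y) ≡ Sₛ i X ∩ Sₛ i Y
  S-∩ 𝟏 = equal₂ (λ X Y → Sₛ 𝟏 (X ∩ Y)) (λ X Y → Sₛ 𝟏 X ∩ Sₛ 𝟏 Y)
  S-∩ 𝟐 = equal₂ (λ X Y → Sₛ 𝟐 (X ∩ Y)) (λ X Y → Sₛ 𝟐 X ∩ Sₛ 𝟐 Y)

  S-∪ : ∀ i {X Y} → X ∈ B → Y ∈ B → Sₛ i (X ∪ Y) ≡ Sₛ i X ∪ Sₛ i Y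
  S-∪ 𝟏 = equal₂ (λ X Y → Sₛ 𝟏 (X ∪ Y)) (λ X Y → Sₛ 𝟏 X ∪ Sₛ 𝟏 Y)
  S-∪ 𝟐 = equal₂ (λ X Y → Sₛ 𝟐 (X ∪ Y)) (λ X Y → Sₛ 𝟐 X ∪ Sₛ 𝟐 Y)

  S-S : ∀ i j {X} → X ∈ B → Sₛ i (Sₛ j X) ≡ Sₛ j X
  S-S 𝟏 𝟏 = equal₁ (λ X → Sₛ 𝟏 (Sₛ 𝟏 X)) (Sₛ 𝟏)
  S-S 𝟏 𝟐 = equal₁ (λ X → Sₛ 𝟏 (Sₛ 𝟐 X)) (Sₛ 𝟐)
  S-S 𝟐 𝟏 = equal₁ (λ X → Sₛ 𝟐 (Sₛ 𝟏 X)) (Sₛ 𝟏)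
  S-S 𝟐 𝟐 = equal₁ (λ X → Sₛ 𝟐 (Sₛ 𝟐 X)) (Sₛ 𝟐)

infix 4 _⊨BT_
_⊨BT_ : {VarProp : Set v} → Pred (For VarProp) ℓ → For VarProp → Set (v ⊔ ℓ)
Γ ⊨BT α = Γ ⊨[ BT ] α

{-# OPTIONS --safe #-}
module Submission where

open import Defs
open import Data.Nat.Base using (ℕ)
open import Function.Bundles using (_↣_; _⇔_)
open import Level using (Level)
open import Relation.Unary using (Pred)

open import Data.Bool.Base using (Bool; true; false; not) renaming (_∧_ to _∧ᵇ_; _∨_ to _∨ᵇ_)
import Data.Bool.Properties as Bool
import Data.Fin.Subset as Subset
open import Data.List.Base using (List; []; _∷_; _++_; map; concat)
open import Data.List.Relation.Unary.All as All using (All; []; _∷_; all?)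
import Data.List.Relation.Unary.All.Properties as All
open import Data.List.Relation.Unary.Any using (here; there)
open import Data.List.Membership.Propositional using (find)
open import Data.Nat.Properties using (_≟_)
open import Data.Product.Base using (_,_)
open import Data.Vec.Base using (lookup)
open import Data.Vec.Properties using (lookup-zipWith)
open import Function.Base using (_∘_)
open import Function.Bundles using (mk⇔)
open import Level using (_⊔_; Lift; lift; lower)
open import Relation.Binary.Definitions using (DecidableEquality)
open import Relation.Binary.Lattice.Bundles using (HeytingAlgebra)
open import Relation.Binary.PropositionalEquality using (_≡_; refl; cong; subst)
open import Relation.Nullary.Decidable using (yes; no; from-yes; via-injection)
import Relation.Binary.Lattice.Properties.HeytingAlgebra as HeytingProperties
import Relation.Binary.Lattice.Properties.JoinSemilattice as JoinProperties

{- For a BT-valuation e and an element x of an HT-algebra A with model h, say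
   that x decides φ as e does when, for i = 1, 2, x lies below Sᵢ(h φ) or below
   ¬ Sᵢ(h φ) according to whether tᵢ ∈ e(φ).  The axioms for Sᵢ propagate this
   from the variables to all formulas.  As S₁a and S₂a are complemented and
   S₁a ≤ S₂a, the top of A is a finite join of elements each of which decides
   all variables of Γ and α as some e does.  Such an x is below h(α): if e
   satisfies Γ, then it satisfies α and x ≤ S₁(h α) ≤ h(α); otherwise
   x ≤ ¬ S₁(h γ) = ¬ S₁(1) = 0 for some γ in Γ. -}

private
  variable
    v c ℓ₁ ℓ₂ : Level
    VarProp : Set v

infixr 5 _⇒ᵇ_
_⇒ᵇ_ : Bool → Bool → Bool
a ⇒ᵇ b = not a ∨ᵇ b

-- Copies of an HT-algebra at higher universe levels.

module _ (A : HTAlgebra c ℓ₁ ℓ₂) where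
  open HTAlgebra A

  liftHeyting : ∀ c′ ℓ₁′ ℓ₂′ →
                HeytingAlgebra (c ⊔ c′) (ℓ₁ ⊔ ℓ₁′) (ℓ₂ ⊔ ℓ₂′)
  liftHeyting c′ ℓ₁′ ℓ₂′ = record
    { Carrier = Lift c′ Carrier
    ; _≈_     = λ x y → Lift ℓ₁′ (lower x ≈ lower y)
    ; _≤_     = λ x y → Lift ℓ₂′ (lower x ≤ lower y)
    ; _∨_     = λ x y → lift (lower x ∨ lower y)
    ; _∧_     = λ x y → lift (lower x ∧ lower y)
    ; _⇨_     = λ x y → lift (lower x ⇨ lower y)
    ; ⊤       = lift ⊤
    ; ⊥       = lift ⊥
    ; isHeytingAlgebra = record
      { isBoundedLattice = record
        { isLattice = record
          { isPartialOrder = record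
            { isPreorder = record
              { isEquivalence = record
                { refl  = lift Eq.refl
                ; sym   = λ p → lift (Eq.sym (lower p))
                ; trans = λ p q → lift (Eq.trans (lower p) (lower q))
                }
              ; reflexive = λ p → lift (reflexive (lower p))
              ; trans     = λ p q → lift (trans (lower p) (lower q))
              }
            ; antisym = λ p q → lift (antisym (lower p) (lower q))
            }
          ; supremum = λ x y → lift (x≤x∨y _ _) , lift (y≤x∨y _ _) ,
                       λ z p q → lift (∨-least (lower p) (lower q))
          ; infimum  = λ x y → lift (x∧y≤x _ _) , lift (x∧y≤y _ _) ,
                       λ z p q → lift (∧-greatest (lower p) (lower q))
          }
        ; maximum = λ x → lift (maximum (lower x))
        ; minimum = λ x → lift (minimum (lower x))
        }
      ; exponential = λ w x y → (λ p → lift (transpose-⇨ (lower p)))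
                              , (λ p → lift (transpose-∧ (lower p)))
      }
    }

  liftHT : ∀ c′ ℓ₁′ ℓ₂′ →
           HTAlgebra (c ⊔ c′) (ℓ₁ ⊔ ℓ₁′) (ℓ₂ ⊔ ℓ₂′)
  liftHT c′ ℓ₁′ ℓ₂′ = record
    { heytingAlgebra = liftHeyting c′ ℓ₁′ ℓ₂′
    ; S      = λ i x → lift (S i (lower x))
    ; S-cong = λ i p → lift (S-cong i (lower p))
    ; S-∧    = λ i x y → lift (S-∧ i (lower x) (lower y))
    ; S-∨    = λ i x y → lift (S-∨ i (lower x) (lower y))
    ; S₂-⇨   = λ x y → lift (S₂-⇨ (lower x) (lower y))
    ; S₁-⇨   = λ x y → lift (S₁-⇨ (lower x) (lower y))
    ; S-S    = λ i j x → lift (S-S i j (lower x))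
    ; S₁-≤   = λ x → lift (S₁-≤ (lower x))
    ; S₁-lem = λ x → lift (S₁-lem (lower x))
    }

  -- Every model on `A` becomes one on the copy by composing with `lift`. This makes `BT`, which
  -- lives at level zero, available as an instance of consequence over algebras at arbitrary levels.
  ⊨-liftHT⁻ : ∀ {ℓ} c′ ℓ₁′ ℓ₂′ {Γ : Pred (For VarProp) ℓ} {α} →
              Γ ⊨[ liftHT c′ ℓ₁′ ℓ₂′ ] α → Γ ⊨[ A ] α
  ⊨-liftHT⁻ c′ ℓ₁′ ℓ₂′ Γ⊨α h h-homo h⊨Γ =
    lower (Γ⊨α (lift ∘ h) lifted (λ γ γ∈Γ → lift (h⊨Γ γ γ∈Γ)))
    where
    open IsHomomorphism h-homo
    lifted : IsHomomorphism (liftHT c′ ℓ₁′ ℓ₂′) (lift ∘ h)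
    lifted = record
      { ∧-homo = λ φ ψ → lift (∧-homo φ ψ)
      ; ∨-homo = λ φ ψ → lift (∨-homo φ ψ)
      ; ⇒-homo = λ φ ψ → lift (⇒-homo φ ψ)
      ; ¬-homo = λ φ → lift (¬-homo φ)
      ; S-homo = λ i φ → lift (S-homo i φ)
      }

-- Membership of t₁ and t₂ in elements of `BT`.

pattern bottomᵇ = here refl
pattern middleᵇ = there (here refl)
pattern topᵇ    = there (there (here refl))

infix 8 _[_]
_[_] : ElemBT → Index → Bool
X [ i ] = lookup (set X) i

⊥ᵇ ½ᵇ ⊤ᵇ : ElemBT
⊥ᵇ = _ , bottomᵇ
½ᵇ = _ , middleᵇ
⊤ᵇ = _ , topᵇ

-- Elements of `BT` are up-sets of the chain, and t₁ is its least point.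
t₁∈⇒≡⊤ : ∀ X → X [ 𝟏 ] ≡ true → set X ≡ Subset.⊤
t₁∈⇒≡⊤ (_ , bottomᵇ) ()
t₁∈⇒≡⊤ (_ , middleᵇ) ()
t₁∈⇒≡⊤ (_ , topᵇ)    _ = refl

module BT = HTAlgebra BT

-- Kripke clauses for implication: only t₂ lies above t₂, while both points lie above t₁. They have
-- the shape of the axioms `S₂-⇨` and `S₁-⇨`.
⇨-[𝟐] : ∀ X Y → (X BT.⇨ Y) [ 𝟐 ] ≡ X [ 𝟐 ] ⇒ᵇ Y [ 𝟐 ]
⇨-[𝟐] X Y = All.lookup (All.lookup (from-yes
  (all? (λ X → all? (λ Y → lookup (X ⇒ₛ Y) 𝟐 Bool.≟ (lookup X 𝟐 ⇒ᵇ lookup Y 𝟐))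
    carrierBT) carrierBT)) (mem X)) (mem Y)

⇨-[𝟏] : ∀ X Y → (X BT.⇨ Y) [ 𝟏 ] ≡ (X [ 𝟏 ] ⇒ᵇ Y [ 𝟏 ]) ∧ᵇ (X [ 𝟐 ] ⇒ᵇ Y [ 𝟐 ])
⇨-[𝟏] X Y = All.lookup (All.lookup (from-yes
  (all? (λ X → all? (λ Y → lookup (X ⇒ₛ Y) 𝟏 Bool.≟
      ((lookup X 𝟏 ⇒ᵇ lookup Y 𝟏) ∧ᵇ (lookup X 𝟐 ⇒ᵇ lookup Y 𝟐)))
    carrierBT) carrierBT)) (mem X)) (mem Y)

S-[] : ∀ i j X → (BT.S j X) [ i ] ≡ X [ j ]
S-[] 𝟏 𝟏 (_ , bottomᵇ) = refl
S-[] 𝟏 𝟏 (_ , middleᵇ) = refl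
S-[] 𝟏 𝟏 (_ , topᵇ)    = refl
S-[] 𝟏 𝟐 (_ , bottomᵇ) = refl
S-[] 𝟏 𝟐 (_ , middleᵇ) = refl
S-[] 𝟏 𝟐 (_ , topᵇ)    = refl
S-[] 𝟐 𝟏 (_ , bottomᵇ) = refl
S-[] 𝟐 𝟏 (_ , middleᵇ) = refl
S-[] 𝟐 𝟏 (_ , topᵇ)    = refl
S-[] 𝟐 𝟐 (_ , bottomᵇ) = refl
S-[] 𝟐 𝟐 (_ , middleᵇ) = refl
S-[] 𝟐 𝟐 (_ , topᵇ)    = refl

-- Evaluation of formulas in `BT`.

eval : (VarProp → ElemBT) → For VarProp → ElemBT
eval e (var p)  = e p
eval e (φ `∧ ψ) = eval e φ BT.∧ eval e ψ
eval e (φ `∨ ψ) = eval e φ BT.∨ eval e ψ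
eval e (φ `⇒ ψ) = eval e φ BT.⇨ eval e ψ
eval e (`¬ φ)   = BT.¬ eval e φ
eval e (`S i φ) = BT.S i (eval e φ)

eval-isHomomorphism : (e : VarProp → ElemBT) → IsHomomorphism BT (eval e)
eval-isHomomorphism e = record
  { ∧-homo = λ _ _ → refl
  ; ∨-homo = λ _ _ → refl
  ; ⇒-homo = λ _ _ → refl
  ; ¬-homo = λ _ → refl
  ; S-homo = λ _ _ → refl
  }

vars : For VarProp → List VarProp
vars (var p)  = p ∷ []
vars (φ `∧ ψ) = vars φ ++ vars ψ
vars (φ `∨ ψ) = vars φ ++ vars ψ
vars (φ `⇒ ψ) = vars φ ++ vars ψ
vars (`¬ φ)   = vars φ
vars (`S _ φ) = vars φ

-- Signed elements of a Heyting algebra.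

module Literal (H : HeytingAlgebra c ℓ₁ ℓ₂) where
  open HeytingAlgebra H
  open HeytingProperties H

  literal : Bool → Carrier → Carrier
  literal true  a = a
  literal false a = ¬ a

  private
    variable
      x a b : Carrier

  infixl 4 _·_
  _·_ : x ≤ a ⇨ b → x ≤ a → x ≤ b
  p · q = trans (∧-greatest p q) ⇨-eval

  literal-cong : ∀ β → a ≈ b → literal β a ≈ literal β b
  literal-cong true  a≈b = a≈b
  literal-cong false a≈b = ⇨-cong a≈b Eq.refl

  -- This and the next two lemmas are the classical truth tables. They hold in every Heyting algebra
  -- because below `x` the sign of each argument is already known, so excluded middle is never
  -- invoked.
  literal-∧ : ∀ β γ → x ≤ literal β a → x ≤ literal γ b → x ≤ literal (β ∧ᵇ γ) (a ∧ b)
  literal-∧ true  true  p q = ∧-greatest p q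
  literal-∧ true  false p q = trans q (⇨ˡ-contravariant (x∧y≤y _ _))
  literal-∧ false γ     p q = trans p (⇨ˡ-contravariant (x∧y≤x _ _))

  literal-∨ : ∀ β γ → x ≤ literal β a → x ≤ literal γ b → x ≤ literal (β ∨ᵇ γ) (a ∨ b)
  literal-∨ true  γ     p q = trans p (x≤x∨y _ _)
  literal-∨ false true  p q = trans q (y≤x∨y _ _)
  literal-∨ false false p q = trans (∧-greatest p q) (⇨-distribˡ-∨-∧-≥ _ _ _)

  literal-⇨ : ∀ β γ → x ≤ literal β a → x ≤ literal γ b → x ≤ literal (β ⇒ᵇ γ) (a ⇨ b)
  literal-⇨ true  true  p q = trans q y≤x⇨y
  literal-⇨ true  false p q =
    transpose-⇨ (trans (x∧y≤x _ _) q · (x∧y≤y _ _ · trans (x∧y≤x _ _) p))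
  literal-⇨ false γ     p q = trans p (⇨ʳ-covariant (minimum _))

-- Consequences of the axioms for `S`.

module _ (A : HTAlgebra c ℓ₁ ℓ₂) where
  open HTAlgebra A hiding (refl)
  open HeytingProperties heytingAlgebra
    using (⇨-unit; ⇨-cong; ⇨ˡ-contravariant; ∧-distribˡ-∨-≤)
  open JoinProperties joinSemilattice using (x≤y⇒x∨y≈y; ∨-cong)
  open Literal heytingAlgebra

  S₁-deflationary : ∀ a → S 𝟏 a ≤ a
  S₁-deflationary a = trans (x≤x∨y _ _) (reflexive (S₁-≤ a))

  S-monotone : ∀ i {a b} → a ≤ b → S i a ≤ S i b
  S-monotone i {a} {b} a≤b = begin
    S i a         ≤⟨ x≤x∨y _ _ ⟩
    S i a ∨ S i b ≈⟨ Eq.sym (S-∨ i a b) ⟩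
    S i (a ∨ b)   ≈⟨ S-cong i (x≤y⇒x∨y≈y a≤b) ⟩
    S i b         ∎
    where open import Relation.Binary.Reasoning.PartialOrder poset

  -- Apply `S 𝟐` to `S 𝟏 a ≤ a`; it fixes the left side.
  S₁≤S₂ : ∀ a → S 𝟏 a ≤ S 𝟐 a
  S₁≤S₂ a = trans (reflexive (Eq.sym (S-S 𝟐 𝟏 a))) (S-monotone 𝟐 (S₁-deflationary a))

  -- The axiom `S₁-lem` is used at `S i a`, which `S 𝟏` fixes; so `S 𝟐 a` is complemented too.
  S-lem : ∀ i a → ⊤ ≤ S i a ∨ ¬ S i a
  S-lem i a = reflexive (Eq.trans (Eq.sym (S₁-lem (S i a)))
    (∨-cong (S-S 𝟏 i a) (⇨-cong (S-S 𝟏 i a) Eq.refl)))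

  S-⊥≤⊥ : ∀ i → S i ⊥ ≤ ⊥
  S-⊥≤⊥ 𝟏 = S₁-deflationary ⊥
  S-⊥≤⊥ 𝟐 = begin
    -- Detour through `S 𝟏 ⊥`, since `S 𝟐` fixes it and `S 𝟏` is deflationary.
    S 𝟐 ⊥       ≤⟨ S-monotone 𝟐 (minimum _) ⟩
    S 𝟐 (S 𝟏 ⊥) ≈⟨ S-S 𝟐 𝟏 ⊥ ⟩
    S 𝟏 ⊥       ≤⟨ S₁-deflationary ⊥ ⟩
    ⊥           ∎
    where open import Relation.Binary.Reasoning.PartialOrder poset

  -- Writing `⊤` as `⊤ ⇨ ⊤` turns `S 𝟏 ⊤` into a meet of two implications of the form `a ⇨ a`.
  ⊤≤S₁⊤ : ⊤ ≤ S 𝟏 ⊤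
  ⊤≤S₁⊤ = begin
    ⊤                                   ≤⟨ ∧-greatest ⊤≤a⇨a ⊤≤a⇨a ⟩
    (S 𝟏 ⊤ ⇨ S 𝟏 ⊤) ∧ (S 𝟐 ⊤ ⇨ S 𝟐 ⊤) ≈⟨ Eq.sym (S₁-⇨ ⊤ ⊤) ⟩
    S 𝟏 (⊤ ⇨ ⊤)                         ≈⟨ S-cong 𝟏 ⇨-unit ⟩
    S 𝟏 ⊤                               ∎
    where
    open import Relation.Binary.Reasoning.PartialOrder poset
    ⊤≤a⇨a : ∀ {a} → ⊤ ≤ a ⇨ a
    ⊤≤a⇨a = reflexive (Eq.sym ⇨-unit)

  -- Elements deciding values in `BT`, and closure under the connectives.

  record Decides (x : Carrier) (X : ElemBT) (a : Carrier) : Set ℓ₂ where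
    constructor decides
    field below : ∀ i → x ≤ literal (X [ i ]) (S i a)

  open Decides

  private
    variable
      x y a b : Carrier
      X Y : ElemBT

  Decides-≤ : y ≤ x → Decides x X a → Decides y X a
  Decides-≤ y≤x d .below i = trans y≤x (d .below i)

  Decides-≈ : a ≈ b → Decides x X a → Decides x X b
  Decides-≈ {X = X} a≈b d .below i =
    trans (d .below i) (reflexive (literal-cong (X [ i ]) (S-cong i a≈b)))

  private
    transport : ∀ {β γ} → γ ≡ β → a ≈ b → x ≤ literal β a → x ≤ literal γ b
    transport {β = β} refl a≈b p = trans p (reflexive (literal-cong β a≈b))

  Decides-∧ : Decides x X a → Decides x Y b → Decides x (X BT.∧ Y) (a ∧ b)
  Decides-∧ {X = X} {Y = Y} d e .below i =
    transport (lookup-zipWith _ i (set X) (set Y)) (Eq.sym (S-∧ i _ _))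
      (literal-∧ (X [ i ]) (Y [ i ]) (d .below i) (e .below i))

  Decides-∨ : Decides x X a → Decides x Y b → Decides x (X BT.∨ Y) (a ∨ b)
  Decides-∨ {X = X} {Y = Y} d e .below i =
    transport (lookup-zipWith _ i (set X) (set Y)) (Eq.sym (S-∨ i _ _))
      (literal-∨ (X [ i ]) (Y [ i ]) (d .below i) (e .below i))

  Decides-⇨ : Decides x X a → Decides x Y b → Decides x (X BT.⇨ Y) (a ⇨ b)
  Decides-⇨ {x = x} {X = X} {a = a} {Y = Y} {b = b} d e = decides λ where
      𝟏 → transport (⇨-[𝟏] X Y) (Eq.sym (S₁-⇨ _ _))
            (literal-∧ (X [ 𝟏 ] ⇒ᵇ Y [ 𝟏 ]) _ (implication 𝟏) (implication 𝟐))
      𝟐 → transport (⇨-[𝟐] X Y) (Eq.sym (S₂-⇨ _ _)) (implication 𝟐)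
    where
    implication : ∀ i → x ≤ literal (X [ i ] ⇒ᵇ Y [ i ]) (S i a ⇨ S i b)
    implication i = literal-⇨ (X [ i ]) (Y [ i ]) (d .below i) (e .below i)

  -- Serves negation, which is implication into `⊥`.
  Decides-⊥ : Decides x BT.⊥ ⊥
  Decides-⊥ = decides λ where
    𝟏 → transpose-⇨ (trans (x∧y≤y _ _) (S-⊥≤⊥ 𝟏))
    𝟐 → transpose-⇨ (trans (x∧y≤y _ _) (S-⊥≤⊥ 𝟐))

  Decides-S : ∀ j → Decides x X a → Decides x (BT.S j X) (S j a)
  Decides-S {X = X} j d .below i =
    transport (S-[] i j X) (Eq.sym (S-S i j _)) (d .below j)

  -- Covering the top by pieces that decide all variables.

  ∨-cases : ⊤ ≤ a ∨ b → x ∧ a ≤ y → x ∧ b ≤ y → x ≤ y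
  ∨-cases ⊤≤a∨b p q =
    trans (∧-greatest (reflexive Eq.refl) (trans (maximum _) ⊤≤a∨b))
      (trans (∧-distribˡ-∨-≤ _ _ _) (∨-least p q))

  -- Cutting `x` along `S 𝟐 a`, and the positive piece along `S 𝟏 a`, gives one piece per element of
  -- `BT`. The negative piece needs no second cut: there `¬ S 𝟐 a ≤ ¬ S 𝟏 a`. The cover is expressed
  -- as case analysis for bounds on `x`, without naming a join.
  Decides-split : ∀ x a {y} → (∀ x′ X → x′ ≤ x → Decides x′ X a → x′ ≤ y) → x ≤ y
  Decides-split x a below-y =
    ∨-cases (S-lem 𝟐 a)
      (∨-cases (S-lem 𝟏 a)
        (below-y _ ⊤ᵇ (trans (x∧y≤x _ _) (x∧y≤x _ _)) (decides λ where
          𝟏 → x∧y≤y _ _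
          𝟐 → trans (x∧y≤x _ _) (x∧y≤y _ _)))
        (below-y _ ½ᵇ (trans (x∧y≤x _ _) (x∧y≤x _ _)) (decides λ where
          𝟏 → x∧y≤y _ _
          𝟐 → trans (x∧y≤x _ _) (x∧y≤y _ _))))
      (below-y _ ⊥ᵇ (x∧y≤x _ _) (decides λ where
          𝟏 → trans (x∧y≤y _ _) (⇨ˡ-contravariant (S₁≤S₂ a))
          𝟐 → x∧y≤y _ _))

  module _ {VarProp : Set v} (_≟ᵥ_ : DecidableEquality VarProp) (g : VarProp → Carrier) where

    DecidesVar : Carrier → (VarProp → ElemBT) → VarProp → Set ℓ₂
    DecidesVar x e p = Decides x (e p) (g p)

    update : VarProp → ElemBT → (VarProp → ElemBT) → VarProp → ElemBT
    update p X e q with p ≟ᵥ q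
    ... | yes _ = X
    ... | no  _ = e q

    -- If `q` is `p`, the old value is overwritten by one that `x` also decides; hence repetitions
    -- in a list of variables do no harm.
    DecidesVar-update : ∀ {e p} → Decides x X (g p) →
                        ∀ {q} → DecidesVar x e q → DecidesVar x (update p X e) q
    DecidesVar-update {p = p} d {q} d′ with p ≟ᵥ q
    ... | yes refl = d
    ... | no  _    = d′

    DecidesVar-updated : ∀ {e p} → Decides x X (g p) → DecidesVar x (update p X e) p
    DecidesVar-updated {p = p} d with p ≟ᵥ p
    ... | yes _   = d
    ... | no  p≢p with () ← p≢p refl

    ⊤≤-byValuations : ∀ ps → (∀ x e → All (DecidesVar x e) ps → x ≤ y) → ⊤ ≤ y
    -- `⊥ᵇ` is an arbitrary default: no variable is constrained yet.
    ⊤≤-byValuations []       below-y = below-y ⊤ (λ _ → ⊥ᵇ) []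
    ⊤≤-byValuations (p ∷ ps) below-y = ⊤≤-byValuations ps λ x e ds →
      Decides-split x (g p) λ x′ X x′≤x d →
        below-y x′ (update p X e)
          (DecidesVar-updated d ∷
           All.map (λ d′ → DecidesVar-update d (Decides-≤ x′≤x d′)) ds)

  -- From variables to formulas.

  module _ {VarProp : Set v} {h : For VarProp → Carrier} (h-homo : IsHomomorphism A h) where
    open IsHomomorphism h-homo

    Decides-eval : ∀ e φ → All (λ p → Decides x (e p) (h (var p))) (vars φ) →
                   Decides x (eval e φ) (h φ)
    Decides-eval e (var p)  (d ∷ []) = d
    Decides-eval e (φ `∧ ψ) ds = Decides-≈ (Eq.sym (∧-homo φ ψ)) (Decides-∧
      (Decides-eval e φ (All.++⁻ˡ (vars φ) ds)) (Decides-eval e ψ (All.++⁻ʳ (vars φ) ds)))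
    Decides-eval e (φ `∨ ψ) ds = Decides-≈ (Eq.sym (∨-homo φ ψ)) (Decides-∨
      (Decides-eval e φ (All.++⁻ˡ (vars φ) ds)) (Decides-eval e ψ (All.++⁻ʳ (vars φ) ds)))
    Decides-eval e (φ `⇒ ψ) ds = Decides-≈ (Eq.sym (⇒-homo φ ψ)) (Decides-⇨
      (Decides-eval e φ (All.++⁻ˡ (vars φ) ds)) (Decides-eval e ψ (All.++⁻ʳ (vars φ) ds)))
    Decides-eval e (`¬ φ)   ds =
      Decides-≈ (Eq.sym (¬-homo φ)) (Decides-⇨ (Decides-eval e φ ds) Decides-⊥)
    Decides-eval e (`S i φ) ds =
      Decides-≈ (Eq.sym (S-homo i φ)) (Decides-S i (Decides-eval e φ ds))

  -- From consequence over `BT` to consequence over `A`.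

  Decides-true⇒≤ : X [ 𝟏 ] ≡ true → Decides x X a → x ≤ a
  Decides-true⇒≤ {a = a} eq d =
    trans (subst (λ β → _ ≤ literal β (S 𝟏 a)) eq (d .below 𝟏)) (S₁-deflationary a)

  -- Here `x` lies below `¬ S 𝟏 a`, while `S 𝟏 a` equals `S 𝟏 ⊤` and hence `⊤`; so `x` is below `⊥`.
  Decides-false⇒≤ : X [ 𝟏 ] ≡ false → a ≈ ⊤ → Decides x X a → x ≤ y
  Decides-false⇒≤ {a = a} eq a≈⊤ d = trans
    (subst (λ β → _ ≤ literal β (S 𝟏 a)) eq (d .below 𝟏) ·
      trans (maximum _) (trans ⊤≤S₁⊤ (reflexive (S-cong 𝟏 (Eq.sym a≈⊤)))))
    (minimum _)

  ⊨BT⇒⊨ : ∀ {ℓ} {VarProp : Set v} → DecidableEquality VarProp →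
          {Γ : Pred (For VarProp) ℓ} → Finite Γ → ∀ {α} → Γ ⊨BT α → Γ ⊨[ A ] α
  ⊨BT⇒⊨ _≟ᵥ_ {Γ} (γs , Γ⊆γs , γs⊆Γ) {α} Γ⊨α h h-homo h⊨Γ =
    antisym (maximum _) (⊤≤-byValuations _≟ᵥ_ (h ∘ var) (concat (map vars (α ∷ γs))) below-hα)
    where
    below-hα : ∀ x e → All (λ p → Decides x (e p) (h (var p))) (concat (map vars (α ∷ γs))) →
               x ≤ h α
    -- Whether `e` satisfies Γ is decidable: Γ is listed by `γs`, and a value is the top once it
    -- contains t₁. A negative answer therefore yields an explicit member that fails.
    below-hα x e ds with All.map⁻ {xs = α ∷ γs} (All.concat⁻ {xss = map vars (α ∷ γs)} ds)
                       | all? (λ γ → eval e γ [ 𝟏 ] Bool.≟ true) γs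
    ... | dα ∷ _   | yes e⊨γs = Decides-true⇒≤
            (cong (λ X → lookup X 𝟏) (Γ⊨α (eval e) (eval-isHomomorphism e)
              λ γ γ∈Γ → t₁∈⇒≡⊤ (eval e γ) (All.lookup e⊨γs (Γ⊆γs γ∈Γ))))
            (Decides-eval h-homo e α dα)
    ... | _  ∷ dγs | no e⊭γs
          with find (All.¬All⇒Any¬ (λ γ → eval e γ [ 𝟏 ] Bool.≟ true) γs e⊭γs)
    ...   | γ , γ∈γs , γ≢true = Decides-false⇒≤ (Bool.¬-not γ≢true) (h⊨Γ γ (γs⊆Γ γ∈γs))
            (Decides-eval h-homo e γ (All.lookup dγs γ∈γs))

theorem6p1 : ∀ {v ℓ : Level} (c ℓ₁ ℓ₂ : Level) (VarProp : Set v) → VarProp ↣ ℕ →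
    (Γ : Pred (For VarProp) ℓ) → Finite Γ → (α : For VarProp) →
    (Γ ⊨Alg⟨ c , ℓ₁ , ℓ₂ ⟩ α) ⇔ (Γ ⊨BT α)
theorem6p1 c ℓ₁ ℓ₂ VarProp VarProp↣ℕ Γ Γ-finite α = mk⇔
  (λ Γ⊨α → ⊨-liftHT⁻ BT c ℓ₁ ℓ₂ (Γ⊨α (liftHT BT c ℓ₁ ℓ₂)))
  -- Countability supplies decidable equality of variables, pulled back from `ℕ`, which `update`
  -- needs.
  (λ Γ⊨α A → ⊨BT⇒⊨ A (via-injection VarProp↣ℕ _≟_) Γ-finite Γ⊨α)
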